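{- Let $k\ge 2$ and $1\le r\le k$ be integers, let $U$ be a finite nonempty set, and let $f:\{0,\ldots,k\}^U\to\mathbb{R}_{+}$ be submodular in every orthant and $r$-wise monotone. Let $\mathbf{s}$ be the solution produced by the deterministic greedy algorithm on $f$ (for an arbitrary processing order of $U$), and let $\mathbf{o}$ be an optimal solution, i.e. a maximizer of $f$ over $\{0,\ldots,k\}^U$. Then \[(1+r)f(\mathbf{s})\ \ge\ f(\mathbf{o}).\]
   Context: $\mathbb{R}_{+}$ denotes the non-negative reals. For $s,t\in\{0,\ldots,k\}$ define $\mathrm{min}_0(s,t)=0$ if $s\neq 0$, $t\neq 0$ and $s\neq t$, and $\mathrm{min}_0(s,t)=\min(s,t)$ otherwise; define $\mathrm{max}_0(s,t)=0$ if $s\neq 0$, $t\neq 0$ and $s\neq t$, and $\mathrm{max}_0(s,t)=\max(s,t)$ otherwise. Both are applied coordinate-wise to vectors. Vectors in $\{0,\ldots,k\}^U$ are called partial solutions; an orthant is a vector $\mathbf{x}\in\{1,\ldots,k\}^U$. A partial solution $\mathbf{s}$ is in orthant $\mathbf{x}$ if $s_e\in\{0,x_e\}$ for all $e\in U$. $f$ is submodular in every orthant if for any two partial solutions $\mathbf{a},\mathbf{b}$ in a common orthant, $f(\mathbf{a})+f(\mathbf{b})\ge f(\mathrm{min}_0(\mathbf{a},\mathbf{b}))+f(\mathrm{max}_0(\mathbf{a},\mathbf{b}))$. For $e\in U$, $i\in\{1,\ldots,k\}$ and $\mathbf{s}$ with $s_e=0$, let $f_{i,e}(\mathbf{s})=f(\mathbf{s}+i\cdot\mathbf{1}_e)-f(\mathbf{s})$,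 where $\mathbf{1}_e$ is the unit vector of coordinate $e$. $f$ is $r$-wise monotone if $\sum_{i\in I}f_{i,e}(\mathbf{s})\ge 0$ for every $e\in U$, every $\mathbf{s}$ with $s_e=0$, and every $I\subseteq\{1,\ldots,k\}$ with $|I|=r$. Deterministic greedy algorithm: start with $\mathbf{s}=\mathbf{0}$. Process the elements of $U$ one at a time in an arbitrary order; when processing $e$, compute $y_i=f_{i,e}(\mathbf{s})$ for $i=1,\ldots,k$ with respect to the current $\mathbf{s}$, let $q$ be the smallest index with $y_q=\max(y_1,\ldots,y_k)$, and permanently set $s_e\gets q$. After all elements have been processed, return $\mathbf{s}$. -}

module Defs where

open import Algebra.Bundles.Raw using (RawMonoid)
import Algebra.Construct.NaturalChoice.Max as Max
import Algebra.Construct.NaturalChoice.Min as Min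
import Algebra.Definitions.RawMonoid as RawMonoidDefinitions
open import Data.Bool.Base using (if_then_else_)
open import Data.Fin.Base as Fin using (Fin; zero; suc)
open import Data.Fin.Properties as Fin using ()
open import Data.Fin.Subset using (Subset; ∣_∣)
open import Data.List.Base using (List; []; _∷_)
open import Data.Nat.Base as ℕ using (ℕ)
import Data.Nat.Properties as ℕ
open import Data.Product.Base using (_×_; _,_; ∃-syntax)
open import Data.Rational.Base as ℚ using (ℚ; 0ℚ; ½)
import Data.Rational.Properties as ℚ
open import Data.Rational.Solver using (module +-*-Solver)
open import Data.Sum.Base using (_⊎_)
open import Data.Vec.Base using (Vec; lookup; replicate; zipWith; _[_]≔_)
open import Data.Vec.Functional using (Vector)
open import Relation.Binary.PropositionalEquality
  using (_≡_; _≢_; refl; sym; cong; trans; subst)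
open import Relation.Nullary.Decidable using (Dec; does; ¬?; _×-dec_)

-- The real numbers, as Cauchy sequences of rationals taken up to _≈_.

IsCauchy : (ℕ → ℚ) → Set
IsCauchy x = ∀ ε → 0ℚ ℚ.< ε →
  ∃[ N ] (∀ m n → N ℕ.≤ m → N ℕ.≤ n → ℚ.∣ x m ℚ.- x n ∣ ℚ.< ε)

record ℝ : Set where
  constructor mkℝ
  field
    seq      : ℕ → ℚ
    isCauchy : IsCauchy seq

open ℝ public

infix  4 _≈_ _≤_ _≥_
infixl 6 _+_ _-_
infix  8 -_

_≈_ : ℝ → ℝ → Set
x ≈ y = ∀ ε → 0ℚ ℚ.< ε →
  ∃[ N ] (∀ n → N ℕ.≤ n → ℚ.∣ seq x n ℚ.- seq y n ∣ ℚ.< ε)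

_≤_ : ℝ → ℝ → Set
x ≤ y = ∀ ε → 0ℚ ℚ.< ε →
  ∃[ N ] (∀ n → N ℕ.≤ n → seq x n ℚ.< seq y n ℚ.+ ε)

_≥_ : ℝ → ℝ → Set
x ≥ y = y ≤ x

0ℝ : ℝ
0ℝ = mkℝ (λ _ → 0ℚ) (λ _ 0<ε → 0 , λ _ _ _ _ → 0<ε)

private
  ½*-pos : ∀ {ε} → 0ℚ ℚ.< ε → 0ℚ ℚ.< ½ ℚ.* ε
  ½*-pos {ε} 0<ε = subst (ℚ._< ½ ℚ.* ε) (ℚ.*-zeroʳ ½) (ℚ.*-monoʳ-<-pos ½ 0<ε)

  halves : ∀ ε → ½ ℚ.* ε ℚ.+ ½ ℚ.* ε ≡ ε
  halves ε = trans (sym (ℚ.*-distribʳ-+ ε ½ ½)) (ℚ.*-identityˡ ε)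

  +-interchange : ∀ a b c d → (a ℚ.+ b) ℚ.- (c ℚ.+ d) ≡ (a ℚ.- c) ℚ.+ (b ℚ.- d)
  +-interchange = solve 4 (λ a b c d → (a :+ b) :- (c :+ d) := (a :- c) :+ (b :- d)) refl
    where open +-*-Solver

  neg-difference : ∀ a b → (ℚ.- a) ℚ.- (ℚ.- b) ≡ ℚ.- (a ℚ.- b)
  neg-difference = solve 2 (λ a b → (:- a) :- (:- b) := :- (a :- b)) refl
    where open +-*-Solver

_+_ : ℝ → ℝ → ℝ
seq      (x + y) n     = seq x n ℚ.+ seq y n
isCauchy (x + y) ε 0<ε with isCauchy x (½ ℚ.* ε) (½*-pos 0<ε)
                          | isCauchy y (½ ℚ.* ε) (½*-pos 0<ε)
... | M , p | N , q = M ℕ.⊔ N , λ m n M⊔N≤m M⊔N≤n → begin-strict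
  ℚ.∣ (seq x m ℚ.+ seq y m) ℚ.- (seq x n ℚ.+ seq y n) ∣
    ≡⟨ cong ℚ.∣_∣ (+-interchange (seq x m) (seq y m) (seq x n) (seq y n)) ⟩
  ℚ.∣ (seq x m ℚ.- seq x n) ℚ.+ (seq y m ℚ.- seq y n) ∣
    ≤⟨ ℚ.∣p+q∣≤∣p∣+∣q∣ (seq x m ℚ.- seq x n) (seq y m ℚ.- seq y n) ⟩
  ℚ.∣ seq x m ℚ.- seq x n ∣ ℚ.+ ℚ.∣ seq y m ℚ.- seq y n ∣
    <⟨ ℚ.+-mono-< (p m n (ℕ.m⊔n≤o⇒m≤o M N M⊔N≤m) (ℕ.m⊔n≤o⇒m≤o M N M⊔N≤n))
                  (q m n (ℕ.m⊔n≤o⇒n≤o M N M⊔N≤m) (ℕ.m⊔n≤o⇒n≤o M N M⊔N≤n)) ⟩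
  ½ ℚ.* ε ℚ.+ ½ ℚ.* ε
    ≡⟨ halves ε ⟩
  ε ∎
  where open ℚ.≤-Reasoning

-_ : ℝ → ℝ
seq      (- x) n     = ℚ.- seq x n
isCauchy (- x) ε 0<ε with isCauchy x ε 0<ε
... | N , p = N , λ m n N≤m N≤n →
  subst (ℚ._< ε)
    (sym (trans (cong ℚ.∣_∣ (neg-difference (seq x m) (seq x n)))
                (ℚ.∣-p∣≡∣p∣ (seq x m ℚ.- seq x n))))
    (p m n N≤m N≤n)

_-_ : ℝ → ℝ → ℝ
x - y = x + (- y)

+-0-rawMonoid : RawMonoid _ _
+-0-rawMonoid = record { Carrier = ℝ ; _≈_ = _≈_ ; _∙_ = _+_ ; ε = 0ℝ }

-- n · x is the sum of n copies of x.
open RawMonoidDefinitions +-0-rawMonoid public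
  using (sum) renaming (_×_ to _·_)

∑[i∈_] : ∀ {k} → Subset k → Vector ℝ k → ℝ
∑[i∈ I ] y = sum (λ i → if lookup I i then y i else 0ℝ)

-- The ground set U is Fin n.  The labels {0,…,k} are Fin (suc k), and
-- i : Fin k stands for the nonzero label suc i, so Fin k plays the role of
-- {1,…,k}.

PartialSolution : ℕ → ℕ → Set
PartialSolution k n = Vec (Fin (ℕ.suc k)) n

Orthant : ℕ → ℕ → Set
Orthant k n = Vec (Fin k) n

InOrthant : ∀ {k n} → PartialSolution k n → Orthant k n → Set
InOrthant s x = ∀ e → lookup s e ≡ zero ⊎ lookup s e ≡ suc (lookup x e)

module _ {k : ℕ} where

  open Min (Fin.≤-totalOrder (ℕ.suc k)) using (_⊓_)
  open Max (Fin.≤-totalOrder (ℕ.suc k)) using (_⊔_)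

  conflict? : (s t : Fin (ℕ.suc k)) → Dec (s ≢ zero × t ≢ zero × s ≢ t)
  conflict? s t = ¬? (s Fin.≟ zero) ×-dec ¬? (t Fin.≟ zero) ×-dec ¬? (s Fin.≟ t)

  min₀ : Fin (ℕ.suc k) → Fin (ℕ.suc k) → Fin (ℕ.suc k)
  min₀ s t = if does (conflict? s t) then zero else s ⊓ t

  max₀ : Fin (ℕ.suc k) → Fin (ℕ.suc k) → Fin (ℕ.suc k)
  max₀ s t = if does (conflict? s t) then zero else s ⊔ t

module _ {k n : ℕ} (f : PartialSolution k n → ℝ) where

  NonNegative : Set
  NonNegative = ∀ s → f s ≥ 0ℝ

  SubmodularInEveryOrthant : Set
  SubmodularInEveryOrthant = ∀ a b →
    ∃[ x ] (InOrthant a x × InOrthant b x) →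
    f a + f b ≥ f (zipWith min₀ a b) + f (zipWith max₀ a b)

  -- Only meaningful when lookup s e ≡ zero, in which case the update
  -- s [ e ]≔ suc i is the vector s + (suc i)·𝟏ₑ.
  marginal : PartialSolution k n → Fin n → Vector ℝ k
  marginal s e i = f (s [ e ]≔ suc i) - f s

  _-WiseMonotone : ℕ → Set
  r -WiseMonotone = ∀ e s → lookup s e ≡ zero →
    ∀ (I : Subset k) → ∣ I ∣ ≡ r → ∑[i∈ I ] (marginal s e) ≥ 0ℝ

  IsOptimal : PartialSolution k n → Set
  IsOptimal o = ∀ t → f t ≤ f o

AttainsMax : ∀ {k} → Vector ℝ k → Fin k → Set
AttainsMax y q = ∀ i → y i ≤ y q

IsSmallestArgmax : ∀ {k} → Vector ℝ k → Fin k → Set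
IsSmallestArgmax y q = AttainsMax y q × (∀ i → AttainsMax y i → q Fin.≤ i)

-- The order on ℝ is not decidable, so the algorithm is given by its graph:
-- GreedyRun f es s t says that processing the elements es one after the
-- other, from the current solution s, ends in the solution t.
data GreedyRun {k n : ℕ} (f : PartialSolution k n → ℝ) :
       List (Fin n) → PartialSolution k n → PartialSolution k n → Set where
  done : ∀ {s} → GreedyRun f [] s s
  step : ∀ {e es s t q} →
         IsSmallestArgmax (marginal f s e) q →
         GreedyRun f es (s [ e ]≔ suc q) t →
         GreedyRun f (e ∷ es) s t

𝟎 : ∀ {k n} → PartialSolution k n
𝟎 = replicate _ zero

{-# OPTIONS --safe #-}

-- Let the hybrid solution o start at the optimum and receive the greedy label q
-- of each processed element e, alongside the greedy solution s, and let t be o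
-- with coordinate e set to 0.  Since s ⪯ t, orthant submodularity bounds every
-- marginal of t at e by the corresponding one of s, hence by the greedy gain y.
-- Removing the old label of e from o thus costs at most y, while r-wise
-- monotonicity at t for a set of labels containing q shows that adding q costs
-- at most (r-1) y.  So f o + r f s never decreases; it starts at no less than the
-- optimum, since f is nonnegative, and ends at (1+r) f s.

module Submission where

open import Defs
open import Data.Nat.Base using (ℕ; suc) renaming (_≤_ to _≤ⁿ_; _+_ to _+ⁿ_)
open import Data.Fin.Base using (Fin)
open import Data.List.Base using (List; allFin)
open import Data.List.Relation.Binary.Permutation.Propositional using (_↭_)

import Algebra.Construct.NaturalChoice.Max as Max
import Algebra.Construct.NaturalChoice.Min as Min
open import Data.Fin.Base using (zero; suc)
import Data.Fin.Properties as Fin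
open import Data.Fin.Subset using (Subset; inside; outside; ∣_∣; ⊥) renaming (_∈_ to _∈ₛ_)
open import Data.Fin.Subset.Properties using (∣⊥∣≡0; x∈p⇒∣p-x∣<∣p∣)
open import Data.List.Base using ([]; _∷_)
open import Data.List.Membership.Propositional using (_∈_)
open import Data.List.Membership.Propositional.Properties using (∈-allFin)
open import Data.List.Relation.Binary.Permutation.Propositional using (↭-sym; ↭⇒↭ₛ)
open import Data.List.Relation.Binary.Permutation.Propositional.Properties using (∈-resp-↭)
import Data.List.Relation.Binary.Permutation.Setoid.Properties as Permutation
open import Data.List.Relation.Unary.All as All using (All; _∷_)
open import Data.List.Relation.Unary.AllPairs using (_∷_)
open import Data.List.Relation.Unary.Any using (here; there)
open import Data.List.Relation.Unary.Unique.Propositional using (Unique)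
open import Data.List.Relation.Unary.Unique.Propositional.Properties using (allFin⁺)
import Data.Nat.Base as ℕ
import Data.Nat.Properties as ℕ
open import Data.Product.Base using (_×_; _,_; ∃-syntax)
open import Data.Rational.Base as ℚ using (ℚ; 0ℚ; ½)
import Data.Rational.Properties as ℚ
open import Data.Rational.Solver using (module +-*-Solver)
open import Data.Sum.Base using (_⊎_; inj₁; inj₂)
open import Data.Vec.Base using ([]; _∷_; here; there; lookup; map; _[_]≔_)
open import Data.Vec.Functional using (Vector)
open import Data.Vec.Properties
  using (lookup-map; lookup-replicate; lookup-zipWith; lookup∘update; lookup∘update′;
         []≔-idempotent; []≔-lookup)
open import Data.Vec.Relation.Binary.Pointwise.Extensional using (Pointwise; ext; Pointwise-≡⇒≡)
open import Function.Base using (_∘_)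
open import Level using (0ℓ)
open import Relation.Binary.Bundles using (Preorder)
open import Relation.Binary.PropositionalEquality
  using (_≡_; refl; sym; trans; cong; subst; subst₂; setoid)
open import Relation.Nullary using (yes; no; contradiction)
open import Relation.Nullary.Decidable using (dec-true)

open Pointwise using (app)
open +-*-Solver using (solve; _:+_; _:-_; :-_; _:=_)

private
  variable
    k m n : ℕ
    x y z u v : ℝ

-- Order and addition on ℝ

-- Pointwise equality is finer than _≈_, but all the identities needed below
-- already hold at every index, where the ring solver for ℚ proves them.
_≐_ : ℝ → ℝ → Set
x ≐ y = ∀ n → seq x n ≡ seq y n

≐⇒≤ : x ≐ y → x ≤ y
≐⇒≤ {x} {y} x≐y ε 0<ε = 0 , λ n _ →
  subst₂ ℚ._<_ (trans (ℚ.+-identityʳ (seq y n)) (sym (x≐y n))) refl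
    (ℚ.+-monoʳ-< (seq y n) 0<ε)

≤-refl : x ≤ x
≤-refl {x} = ≐⇒≤ {x} {x} (λ _ → refl)

½*-pos : ∀ {ε} → 0ℚ ℚ.< ε → 0ℚ ℚ.< ½ ℚ.* ε
½*-pos {ε} 0<ε = subst (ℚ._< ½ ℚ.* ε) (ℚ.*-zeroʳ ½) (ℚ.*-monoʳ-<-pos ½ 0<ε)

halves : ∀ ε → ½ ℚ.* ε ℚ.+ ½ ℚ.* ε ≡ ε
halves ε = trans (sym (ℚ.*-distribʳ-+ ε ½ ½)) (ℚ.*-identityˡ ε)

≤-trans : x ≤ y → y ≤ z → x ≤ z
≤-trans {x} {y} {z} x≤y y≤z ε 0<ε with x≤y (½ ℚ.* ε) (½*-pos 0<ε) | y≤z (½ ℚ.* ε) (½*-pos 0<ε)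
... | M , p | N , q = M ℕ.⊔ N , λ n M⊔N≤n → begin-strict
  seq x n                                    <⟨ p n (ℕ.m⊔n≤o⇒m≤o M N M⊔N≤n) ⟩
  seq y n ℚ.+ ½ ℚ.* ε                        <⟨ ℚ.+-monoˡ-< (½ ℚ.* ε) (q n (ℕ.m⊔n≤o⇒n≤o M N M⊔N≤n)) ⟩
  seq z n ℚ.+ ½ ℚ.* ε ℚ.+ ½ ℚ.* ε            ≡⟨ ℚ.+-assoc (seq z n) (½ ℚ.* ε) (½ ℚ.* ε) ⟩
  seq z n ℚ.+ (½ ℚ.* ε ℚ.+ ½ ℚ.* ε)          ≡⟨ cong (seq z n ℚ.+_) (halves ε) ⟩
  seq z n ℚ.+ ε                              ∎
  where open ℚ.≤-Reasoning

+-mono-≤ : x ≤ y → u ≤ v → x + u ≤ y + v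
+-mono-≤ {x} {y} {u} {v} x≤y u≤v ε 0<ε with x≤y (½ ℚ.* ε) (½*-pos 0<ε) | u≤v (½ ℚ.* ε) (½*-pos 0<ε)
... | M , p | N , q = M ℕ.⊔ N , λ n M⊔N≤n → begin-strict
  seq x n ℚ.+ seq u n
    <⟨ ℚ.+-mono-< (p n (ℕ.m⊔n≤o⇒m≤o M N M⊔N≤n)) (q n (ℕ.m⊔n≤o⇒n≤o M N M⊔N≤n)) ⟩
  (seq y n ℚ.+ ½ ℚ.* ε) ℚ.+ (seq v n ℚ.+ ½ ℚ.* ε)
    ≡⟨ interchange (seq y n) (½ ℚ.* ε) (seq v n) (½ ℚ.* ε) ⟩
  (seq y n ℚ.+ seq v n) ℚ.+ (½ ℚ.* ε ℚ.+ ½ ℚ.* ε)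
    ≡⟨ cong (seq y n ℚ.+ seq v n ℚ.+_) (halves ε) ⟩
  seq y n ℚ.+ seq v n ℚ.+ ε ∎
  where
  open ℚ.≤-Reasoning
  interchange : ∀ a b c d → (a ℚ.+ b) ℚ.+ (c ℚ.+ d) ≡ (a ℚ.+ c) ℚ.+ (b ℚ.+ d)
  interchange = solve 4 (λ a b c d → (a :+ b) :+ (c :+ d) := (a :+ c) :+ (b :+ d)) refl

≤-preorder : Preorder 0ℓ 0ℓ 0ℓ
≤-preorder = record
  { Carrier    = ℝ
  ; _≈_        = _≐_
  ; _≲_        = _≤_
  ; isPreorder = record
    { isEquivalence = record
      { refl  = λ _ → refl
      ; sym   = λ x≐y → sym ∘ x≐y
      ; trans = λ x≐y y≐z n → trans (x≐y n) (y≐z n)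
      }
    ; reflexive = λ {x} {y} → ≐⇒≤ {x} {y}
    ; trans     = λ {x} {y} {z} → ≤-trans {x} {y} {z}
    }
  }

open import Relation.Binary.Reasoning.Preorder ≤-preorder

·-nonneg : ∀ m → 0ℝ ≤ x → 0ℝ ≤ m · x
·-nonneg     ℕ.zero  0≤x = ≤-refl {0ℝ}
·-nonneg {x} (suc m) 0≤x = +-mono-≤ {0ℝ} {x} {0ℝ} {m · x} 0≤x (·-nonneg {x} m 0≤x)

·-nonpos : ∀ m {j} → seq x j ℚ.≤ 0ℚ → seq (m · x) j ℚ.≤ 0ℚ
·-nonpos     ℕ.zero  x≤0 = ℚ.≤-refl
·-nonpos {x} (suc m) x≤0 = ℚ.+-mono-≤ x≤0 (·-nonpos {x} m x≤0)

-- The sign of each rational term is decidable. Where the term `seq x j` is negative, the other `m`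
-- copies only lower the sum, so any lower bound on `suc m · x` at `j` also bounds `seq x j`, with
-- the same `ε` and no division.
·-cancel-nonneg : ∀ m → 0ℝ ≤ suc m · x → 0ℝ ≤ x
·-cancel-nonneg {x} m 0≤mx ε 0<ε with 0≤mx ε 0<ε
... | N , p = N , positive
  where
  positive : ∀ j → N ≤ⁿ j → 0ℚ ℚ.< seq x j ℚ.+ ε
  positive j N≤j with 0ℚ ℚ.≤? seq x j
  ... | yes 0≤xⱼ = ℚ.+-mono-≤-< 0≤xⱼ 0<ε
  ... | no  0≰xⱼ = ℚ.<-≤-trans (p j N≤j)
    (ℚ.+-monoˡ-≤ ε (subst (seq (suc m · x) j ℚ.≤_) (ℚ.+-identityʳ (seq x j))
      (ℚ.+-monoʳ-≤ (seq x j) (·-nonpos {x} m (ℚ.<⇒≤ (ℚ.≰⇒> 0≰xⱼ))))))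

·-difference : ∀ m → ((m · (x - y)) + (m · y)) ≐ (m · x)
·-difference         ℕ.zero  j = refl
·-difference {x} {y} (suc m) j =
  trans (regroup (seq x j) (seq y j) (seq (m · (x - y)) j) (seq (m · y) j))
        (cong (seq x j ℚ.+_) (·-difference {x} {y} m j))
  where
  regroup : ∀ a b c d → ((a ℚ.- b) ℚ.+ c) ℚ.+ (b ℚ.+ d) ≡ a ℚ.+ (c ℚ.+ d)
  regroup = solve 4 (λ a b c d → ((a :- b) :+ c) :+ (b :+ d) := a :+ (c :+ d)) refl

-- The bookkeeping of one greedy step with gain `s′ - s`: dropping the old label costs at most one
-- gain and adding the new one at most `m` gains. These `suc m` gains are exactly what `suc m`
-- copies of `s` earn.
exchange : ∀ m o t o′ s s′ → o ≤ t + (s′ - s) → 0ℝ ≤ (o′ - t) + m · (s′ - s) →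
           o + suc m · s ≤ o′ + suc m · s′
exchange m o t o′ s s′ dropped gained = begin
  o + S
    ≈⟨ (λ j → cong (ℚ._+ seq S j) (sym (ℚ.+-identityʳ (seq o j)))) ⟩
  (o + 0ℝ) + S
    ≲⟨ +-mono-≤ {o + 0ℝ} {(t + Y) + ((o′ - t) + m · Y)} {S} {S}
         (+-mono-≤ {o} {t + Y} {0ℝ} {(o′ - t) + m · Y} dropped gained) (≤-refl {S}) ⟩
  ((t + Y) + ((o′ - t) + m · Y)) + S
    ≈⟨ (λ j → regroup (seq t j) (seq Y j) (seq o′ j) (seq (m · Y) j) (seq S j)) ⟩
  o′ + (suc m · Y + S)
    ≈⟨ (λ j → cong (seq o′ j ℚ.+_) (·-difference {s′} {s} (suc m) j)) ⟩
  o′ + suc m · s′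
    ∎
  where
  S Y : ℝ
  S = suc m · s
  Y = s′ - s
  regroup : ∀ a b c d g → ((a ℚ.+ b) ℚ.+ ((c ℚ.- a) ℚ.+ d)) ℚ.+ g ≡ c ℚ.+ ((b ℚ.+ d) ℚ.+ g)
  regroup = solve 5 (λ a b c d g → ((a :+ b) :+ ((c :- a) :+ d)) :+ g := c :+ ((b :+ d) :+ g)) refl

-- Sums over subsets

∑-≤ : (a : Vector ℝ k) (Y : ℝ) → (∀ i → a i ≤ Y) →
      (I : Subset k) → ∑[i∈ I ] a ≤ ∣ I ∣ · Y
∑-≤ a Y a≤Y []            = ≤-refl {0ℝ}
∑-≤ a Y a≤Y (outside ∷ I) = begin
  0ℝ + ∑[i∈ I ] (a ∘ suc)  ≈⟨ (λ j → ℚ.+-identityˡ _) ⟩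
  ∑[i∈ I ] (a ∘ suc)       ≲⟨ ∑-≤ (a ∘ suc) Y (a≤Y ∘ suc) I ⟩
  ∣ I ∣ · Y                ∎
∑-≤ a Y a≤Y (inside ∷ I) =
  +-mono-≤ {a zero} {Y} {∑[i∈ I ] (a ∘ suc)} {∣ I ∣ · Y}
    (a≤Y zero) (∑-≤ (a ∘ suc) Y (a≤Y ∘ suc) I)

-- The term at `q` is kept exact and only the other `m` terms are replaced by `Y`, so a lower bound
-- on the sum becomes one on `a q`.
∑-≤-∈ : (a : Vector ℝ k) (Y : ℝ) → (∀ i → a i ≤ Y) →
        ∀ {q} (I : Subset k) → q ∈ₛ I → ∣ I ∣ ≡ suc m → ∑[i∈ I ] a ≤ a q + m · Y
∑-≤-∈ a Y a≤Y (inside ∷ I) here refl =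
  +-mono-≤ {a zero} {a zero} {∑[i∈ I ] (a ∘ suc)} {∣ I ∣ · Y}
    (≤-refl {a zero}) (∑-≤ (a ∘ suc) Y (a≤Y ∘ suc) I)
∑-≤-∈ {m = m} a Y a≤Y {suc q} (outside ∷ I) (there q∈I) eq = begin
  0ℝ + ∑[i∈ I ] (a ∘ suc)  ≈⟨ (λ j → ℚ.+-identityˡ _) ⟩
  ∑[i∈ I ] (a ∘ suc)       ≲⟨ ∑-≤-∈ (a ∘ suc) Y (a≤Y ∘ suc) I q∈I eq ⟩
  a (suc q) + m · Y        ∎
-- The tail contains `q`, so its size cannot be 0.
∑-≤-∈ {m = ℕ.zero} a Y a≤Y (inside ∷ I) (there q∈I) eq =
  contradiction (ℕ.suc-injective eq) (ℕ.m<n⇒n≢0 (x∈p⇒∣p-x∣<∣p∣ q∈I))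
∑-≤-∈ {m = suc m} a Y a≤Y {suc q} (inside ∷ I) (there q∈I) eq = begin
  a zero + ∑[i∈ I ] (a ∘ suc)
    ≲⟨ +-mono-≤ {a zero} {Y} {∑[i∈ I ] (a ∘ suc)} {a (suc q) + m · Y}
         (a≤Y zero) (∑-≤-∈ (a ∘ suc) Y (a≤Y ∘ suc) I q∈I (ℕ.suc-injective eq)) ⟩
  Y + (a (suc q) + m · Y)
    ≈⟨ (λ j → swap (seq Y j) (seq (a (suc q)) j) (seq (m · Y) j)) ⟩
  a (suc q) + (Y + m · Y)
    ∎
  where
  swap : ∀ a b c → a ℚ.+ (b ℚ.+ c) ≡ b ℚ.+ (a ℚ.+ c)
  swap = solve 3 (λ a b c → a :+ (b :+ c) := b :+ (a :+ c)) refl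

subset-of-size : m ≤ⁿ k → ∃[ I ] ∣_∣ {k} I ≡ m
subset-of-size {k = k} ℕ.z≤n = ⊥ , ∣⊥∣≡0 k
subset-of-size (ℕ.s≤s m≤k) with subset-of-size m≤k
... | I , ∣I∣≡m = inside ∷ I , cong suc ∣I∣≡m

subset-of-size-∋ : suc m ≤ⁿ k → (q : Fin k) → ∃[ I ] (q ∈ₛ I × ∣ I ∣ ≡ suc m)
subset-of-size-∋ (ℕ.s≤s m≤k) zero with subset-of-size m≤k
... | I , ∣I∣≡m = inside ∷ I , here , cong suc ∣I∣≡m
-- The only place left is reserved for `q`, so position `zero` is skipped; with more places it is
-- taken.
subset-of-size-∋ {ℕ.zero} {suc (suc k)} _ (suc q) with subset-of-size-∋ {ℕ.zero} (ℕ.s≤s ℕ.z≤n) q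
... | I , q∈I , ∣I∣≡1 = outside ∷ I , there q∈I , ∣I∣≡1
subset-of-size-∋ {suc m} (ℕ.s≤s m<k) (suc q) with subset-of-size-∋ m<k q
... | I , q∈I , ∣I∣≡m = inside ∷ I , there q∈I , cong suc ∣I∣≡m

-- Partial solutions

infix 4 _⪯_

_⪯_ : PartialSolution k n → PartialSolution k n → Set
_⪯_ = Pointwise (λ a b → a ≡ zero ⊎ a ≡ b)

min₀-idem : ∀ (s : Fin (suc k)) → min₀ s s ≡ s
min₀-idem zero = refl
min₀-idem {k} (suc s) rewrite dec-true (s Fin.≟ s) refl =
  Min.⊓-idem (Fin.≤-totalOrder (suc k)) (suc s)

max₀-idem : ∀ (s : Fin (suc k)) → max₀ s s ≡ s
max₀-idem zero = refl
max₀-idem {k} (suc s) rewrite dec-true (s Fin.≟ s) refl =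
  Max.⊔-idem (Fin.≤-totalOrder (suc k)) (suc s)

≗⇒≡ : {s t : PartialSolution k n} → (∀ e → lookup s e ≡ lookup t e) → s ≡ t
≗⇒≡ s≗t = Pointwise-≡⇒≡ (ext s≗t)

-- Orthants and submodularity

nonzeroOr : Fin k → Fin (suc k) → Fin k
nonzeroOr i zero    = i
nonzeroOr i (suc j) = j

-- An orthant has no zero coordinate, so the zeros of a partial solution are filled with an
-- arbitrary label `i`. The result is an orthant containing everything below that solution.
complete : Fin k → PartialSolution k n → Orthant k n
complete i = map (nonzeroOr i)

inOrthant-complete : ∀ (i : Fin k) {s t : PartialSolution k n} → s ⪯ t → InOrthant s (complete i t)
inOrthant-complete i {s} {t} s⪯t e rewrite lookup-map e (nonzeroOr i) t
  with lookup s e | lookup t e | app s⪯t e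
... | _     | _     | inj₁ refl = inj₁ refl
... | zero  | zero  | inj₂ refl = inj₁ refl
... | suc j | suc j | inj₂ refl = inj₂ refl

-- The joint graph of `min₀` and `max₀` on label pairs without conflict, the only pairs that arise
-- inside a common orthant.
data MinMax₀ {k} : (a b lo hi : Fin (suc k)) → Set where
  zeroˡ : ∀ {b} → MinMax₀ zero b zero b
  zeroʳ : ∀ {a} → MinMax₀ a zero zero a
  equal : ∀ {a} → MinMax₀ a a a a

min₀-value : ∀ {a b lo hi : Fin (suc k)} → MinMax₀ a b lo hi → min₀ a b ≡ lo
min₀-value             zeroˡ = refl
min₀-value {a = zero}  zeroʳ = refl
min₀-value {a = suc _} zeroʳ = refl
min₀-value {a = a}     equal = min₀-idem a

max₀-value : ∀ {a b lo hi : Fin (suc k)} → MinMax₀ a b lo hi → max₀ a b ≡ hi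
max₀-value {b = zero}  zeroˡ = refl
max₀-value {b = suc _} zeroˡ = refl
max₀-value {a = zero}  zeroʳ = refl
max₀-value {a = suc _} zeroʳ = refl
max₀-value {a = a}     equal = max₀-idem a

-- A common upper bound `u` stands in for the orthant, and the two combined vectors are given by
-- their coordinates.
submodular-⪯ : (f : PartialSolution k n → ℝ) → SubmodularInEveryOrthant f → Fin k →
  ∀ {a b u lo hi} → a ⪯ u → b ⪯ u →
  (∀ e → MinMax₀ (lookup a e) (lookup b e) (lookup lo e) (lookup hi e)) →
  f lo + f hi ≤ f a + f b
submodular-⪯ f submodular i {a} {b} {u} {lo} {hi} a⪯u b⪯u minMax₀ =
  subst₂ (λ lo hi → f lo + f hi ≤ f a + f b)
    (≗⇒≡ λ e → trans (lookup-zipWith min₀ e a b) (min₀-value (minMax₀ e)))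
    (≗⇒≡ λ e → trans (lookup-zipWith max₀ e a b) (max₀-value (minMax₀ e)))
    (submodular a b (complete i u , inOrthant-complete i a⪯u , inOrthant-complete i b⪯u))

-- Submodularity is applied to `s [ e ]≔ suc i` and `t`, both below `t [ e ]≔ suc i`: their `min₀`
-- is `s` and their `max₀` is `t [ e ]≔ suc i`.
diminishing-marginals : (f : PartialSolution k n → ℝ) → SubmodularInEveryOrthant f →
  ∀ {s t e} → s ⪯ t → lookup s e ≡ zero → lookup t e ≡ zero →
  ∀ i → marginal f t e i ≤ marginal f s e i
diminishing-marginals {k} {n} f submodular {s} {t} {e} s⪯t sₑ≡0 tₑ≡0 i = begin
  f (t [ e ]≔ suc i) - f t
    ≈⟨ (λ j → pad (seq (f s) j) (seq (f (t [ e ]≔ suc i)) j) (seq (f t) j)) ⟩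
  (f s + f (t [ e ]≔ suc i)) + (- f s - f t)
    ≲⟨ +-mono-≤ {f s + f (t [ e ]≔ suc i)} {f (s [ e ]≔ suc i) + f t} { - f s - f t} { - f s - f t}
         (submodular-⪯ f submodular i sᵢ⪯tᵢ t⪯tᵢ minMax₀) (≤-refl { - f s - f t}) ⟩
  (f (s [ e ]≔ suc i) + f t) + (- f s - f t)
    ≈⟨ (λ j → unpad (seq (f s) j) (seq (f (s [ e ]≔ suc i)) j) (seq (f t) j)) ⟩
  f (s [ e ]≔ suc i) - f s
    ∎
  where
  pad : ∀ a b c → b ℚ.- c ≡ (a ℚ.+ b) ℚ.+ (ℚ.- a ℚ.- c)
  pad = solve 3 (λ a b c → b :- c := (a :+ b) :+ (:- a :- c)) refl
  unpad : ∀ a b c → (b ℚ.+ c) ℚ.+ (ℚ.- a ℚ.- c) ≡ b ℚ.- a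
  unpad = solve 3 (λ a b c → (b :+ c) :+ (:- a :- c) := b :- a) refl
  t⪯tᵢ : t ⪯ t [ e ]≔ suc i
  app t⪯tᵢ d with d Fin.≟ e
  ... | yes refl = inj₁ tₑ≡0
  ... | no  d≢e  = inj₂ (sym (lookup∘update′ d≢e t (suc i)))
  sᵢ⪯tᵢ : s [ e ]≔ suc i ⪯ t [ e ]≔ suc i
  app sᵢ⪯tᵢ d with d Fin.≟ e
  ... | yes refl rewrite lookup∘update e s (suc i) | lookup∘update e t (suc i) = inj₂ refl
  ... | no  d≢e  rewrite lookup∘update′ d≢e s (suc i) | lookup∘update′ d≢e t (suc i) = app s⪯t d
  minMax₀ : ∀ d → MinMax₀ (lookup (s [ e ]≔ suc i) d) (lookup t d)
                             (lookup s d) (lookup (t [ e ]≔ suc i) d)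
  minMax₀ d with d Fin.≟ e
  ... | yes refl rewrite lookup∘update e s (suc i) | lookup∘update e t (suc i) | sₑ≡0 | tₑ≡0 = zeroʳ
  ... | no  d≢e  rewrite lookup∘update′ d≢e s (suc i) | lookup∘update′ d≢e t (suc i)
    with lookup s d | lookup t d | app s⪯t d
  ...   | _ | _ | inj₁ refl = zeroˡ
  ...   | _ | _ | inj₂ refl = equal

-- Greedy steps and runs, with r = `suc m`

module _ (f : PartialSolution k n → ℝ) (submodular : SubmodularInEveryOrthant f)
         (monotone : (f -WiseMonotone) (suc m)) (m<k : m ℕ.< k) where

  -- Take a set of `suc m` labels containing `q`. Its marginals at `t` have a nonnegative sum, and
  -- each of the `m` labels other than `q` contributes at most its marginal at `s`, hence at most
  -- the greedy gain.
  monotone⇒gain : ∀ e s t (q : Fin k) → s ⪯ t → lookup s e ≡ zero → lookup t e ≡ zero →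
    AttainsMax (marginal f s e) q → 0ℝ ≤ marginal f t e q + m · marginal f s e q
  monotone⇒gain e s t q s⪯t sₑ≡0 tₑ≡0 q-max = let I , q∈I , ∣I∣≡r = subset-of-size-∋ m<k q in begin
    0ℝ
      ≲⟨ monotone e t tₑ≡0 I ∣I∣≡r ⟩
    ∑[i∈ I ] (marginal f t e)
      ≲⟨ ∑-≤-∈ {m = m} (marginal f t e) (marginal f s e q)
           (λ i → ≤-trans {marginal f t e i} {marginal f s e i} {marginal f s e q}
             (diminishing-marginals f submodular s⪯t sₑ≡0 tₑ≡0 i) (q-max i))
           I q∈I ∣I∣≡r ⟩
    marginal f t e q + m · marginal f s e q
      ∎

  -- For `t = s` the preceding bound says that `suc m` copies of the greedy gain are nonnegative.
  max-marginal-nonneg : ∀ e s (q : Fin k) → lookup s e ≡ zero →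
    AttainsMax (marginal f s e) q → 0ℝ ≤ marginal f s e q
  max-marginal-nonneg e s q sₑ≡0 q-max = ·-cancel-nonneg {marginal f s e q} m
    (monotone⇒gain e s s q (ext λ _ → inj₂ refl) sₑ≡0 sₑ≡0 q-max)

  -- If `e` has label 0 in `o`, nothing is lost and the greedy gain is nonnegative. Otherwise the
  -- loss is a marginal at `o [ e ]≔ zero`, bounded by the one at `s` and so by the maximum.
  drop-bound : ∀ e s o (q : Fin k) → s ⪯ o [ e ]≔ zero → lookup s e ≡ zero →
    AttainsMax (marginal f s e) q → f o ≤ f (o [ e ]≔ zero) + marginal f s e q
  drop-bound e s o q s⪯t sₑ≡0 q-max = begin
    f o
      ≈⟨ (λ j → split (seq (f o) j) (seq (f t) j)) ⟩
    f t + (f o - f t)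
      ≲⟨ +-mono-≤ {f t} {f t} {f o - f t} {marginal f s e q} (≤-refl {f t}) (by-label (lookup o e) refl) ⟩
    f t + marginal f s e q
      ∎
    where
    t = o [ e ]≔ zero
    split : ∀ a b → a ≡ b ℚ.+ (a ℚ.- b)
    split = solve 2 (λ a b → a := b :+ (a :- b)) refl
    restore : ∀ {l} → lookup o e ≡ l → t [ e ]≔ l ≡ o
    restore refl = trans ([]≔-idempotent o e) ([]≔-lookup o e)
    by-label : ∀ l → lookup o e ≡ l → f o - f t ≤ marginal f s e q
    by-label zero oₑ≡0 = begin
      f o - f t         ≡⟨ cong (λ o′ → f o′ - f t) (trans (sym ([]≔-lookup o e)) (cong (o [ e ]≔_) oₑ≡0)) ⟩
      f t - f t         ≈⟨ (λ j → ℚ.+-inverseʳ (seq (f t) j)) ⟩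
      0ℝ                ≲⟨ max-marginal-nonneg e s q sₑ≡0 q-max ⟩
      marginal f s e q  ∎
    by-label (suc p) oₑ≡p = begin
      f o - f t         ≡⟨ cong (λ o′ → f o′ - f t) (sym (restore oₑ≡p)) ⟩
      marginal f t e p  ≲⟨ diminishing-marginals f submodular s⪯t sₑ≡0 (lookup∘update e o zero) p ⟩
      marginal f s e p  ≲⟨ q-max p ⟩
      marginal f s e q  ∎

  greedy-step : ∀ e s o (q : Fin k) → s ⪯ o [ e ]≔ zero → lookup s e ≡ zero →
    AttainsMax (marginal f s e) q →
    f o + suc m · f s ≤ f (o [ e ]≔ suc q) + suc m · f (s [ e ]≔ suc q)
  greedy-step e s o q s⪯t sₑ≡0 q-max =
    exchange m (f o) (f (o [ e ]≔ zero)) (f (o [ e ]≔ suc q)) (f s) (f (s [ e ]≔ suc q))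
      (drop-bound e s o q s⪯t sₑ≡0 q-max)
      -- Clearing `e` and then setting it to `suc q` is the same as setting it directly in `o`.
      (subst (λ o′ → 0ℝ ≤ (f o′ - f (o [ e ]≔ zero)) + m · marginal f s e q)
        ([]≔-idempotent o e)
        (monotone⇒gain e s (o [ e ]≔ zero) q s⪯t sₑ≡0 (lookup∘update e o zero) q-max))

  -- Induction on the run. The invariant: `s` is 0 on the elements still to be processed and agrees
  -- with the hybrid `o` on all others.
  greedy-run : ∀ {es s t} (o : PartialSolution k n) → Unique es → GreedyRun f es s t →
    All (λ e → lookup s e ≡ zero) es →
    (∀ e → e ∈ es ⊎ lookup s e ≡ lookup o e) →
    f o + suc m · f s ≤ suc (suc m) · f t
  greedy-run {s = s} o _ done _ agree = begin
    -- No element is left, so `o` equals `s`, and the sum unfolds to `suc (suc m)` copies of `f s`.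
    f o + suc m · f s      ≡⟨ cong (λ o → f o + suc m · f s) (sym (≗⇒≡ λ e → agree-[] (agree e))) ⟩
    suc (suc m) · f s      ∎
    where
    agree-[] : ∀ {e} {A : Set} → e ∈ [] ⊎ A → A
    agree-[] (inj₂ a) = a
  greedy-run {es = e ∷ es} {s} {t} o (e∉es ∷ unique) (step {q = q} (q-max , _) run) (sₑ≡0 ∷ s≡0) agree = begin
    f o + suc m · f s
      ≲⟨ greedy-step e s o q s⪯ sₑ≡0 q-max ⟩
    f (o [ e ]≔ suc q) + suc m · f (s [ e ]≔ suc q)
      ≲⟨ greedy-run (o [ e ]≔ suc q) unique run
           (All.zipWith (λ { (e≢d , s≡0) → trans (lookup∘update′ (e≢d ∘ sym) s (suc q)) s≡0 }) (e∉es , s≡0))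
           agree′ ⟩
    suc (suc m) · f t
      ∎
    where
    s⪯ : s ⪯ o [ e ]≔ zero
    -- Unprocessed coordinates, `e` among them, are 0 in `s`; at the others `s` agrees with `o`,
    -- which is changed only at `e`.
    app s⪯ d with agree d
    ... | inj₁ d∈es = inj₁ (All.lookup (sₑ≡0 ∷ s≡0) d∈es)
    ... | inj₂ s≡o with d Fin.≟ e
    ...   | yes refl = inj₁ sₑ≡0
    ...   | no  d≢e  = inj₂ (trans s≡o (sym (lookup∘update′ d≢e o zero)))
    agree′ : ∀ d → d ∈ es ⊎ lookup (s [ e ]≔ suc q) d ≡ lookup (o [ e ]≔ suc q) d
    agree′ d with d Fin.≟ e
    ... | yes refl = inj₂ (trans (lookup∘update e s (suc q)) (sym (lookup∘update e o (suc q))))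
    ... | no  d≢e rewrite lookup∘update′ d≢e s (suc q) | lookup∘update′ d≢e o (suc q) with agree d
    ...   | inj₁ (here d≡e)   = contradiction d≡e d≢e
    ...   | inj₁ (there d∈es) = inj₁ d∈es
    ...   | inj₂ s≡o          = inj₂ s≡o

theorem15 : (k r n : ℕ) → 2 ≤ⁿ k → 1 ≤ⁿ r → r ≤ⁿ k → 1 ≤ⁿ n →
    (f : PartialSolution k n → ℝ) →
    NonNegative f →
    SubmodularInEveryOrthant f →
    (f -WiseMonotone) r →
    (order : List (Fin n)) → order ↭ allFin n →
    (s : PartialSolution k n) → GreedyRun f order 𝟎 s →
    (o : PartialSolution k n) → IsOptimal f o →
    (1 +ⁿ r) · f s ≥ f o
theorem15 k (suc m) n _ _ m<k _ f nonneg submodular monotone order order↭ s run o _ = begin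
  f o
    ≈⟨ (λ j → sym (ℚ.+-identityʳ (seq (f o) j))) ⟩
  f o + 0ℝ
    ≲⟨ +-mono-≤ {f o} {f o} {0ℝ} {suc m · f 𝟎} (≤-refl {f o}) (·-nonneg {f 𝟎} (suc m) (nonneg 𝟎)) ⟩
  f o + suc m · f 𝟎
    ≲⟨ greedy-run f submodular monotone m<k o unique run
         (All.tabulate (λ {e} _ → lookup-replicate e zero))
         -- At the start every element is still to be processed, so `𝟎` and `o` need not agree
         -- anywhere.
         (λ e → inj₁ (∈-resp-↭ (↭-sym order↭) (∈-allFin e))) ⟩
  suc (suc m) · f s
    ∎
  where
  unique : Unique order
  unique = Permutation.Unique-resp-↭ (setoid (Fin n)) (↭⇒↭ₛ (↭-sym order↭)) (allFin⁺ n)
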